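{- Let $\mathcal{C}$ be a topos and $F:\mathcal{C}\to\mathcal{C}$ an endofunctor. For every relation $U$ from $X$ to $Y$ and all $F$-coalgebras $\alpha:X\to FX$ and $\beta:Y\to FY$, $U$ is a toposal AM-bisimulation from $\alpha$ to $\beta$ if and only if it is a regular AM-bisimulation from $\alpha$ to $\beta$.
   Context: A topos is a finitely complete category with power-objects: for every object $X$ there are an object $\mathcal{P}X$ and a mono $\in_X:E_X\rightarrowtail X\times\mathcal{P}X$ such that for every mono $m:R\rightarrowtail X\times Y$ there is a unique morphism $\xi_m:Y\to\mathcal{P}X$ such that $m$ is a pullback of $\in_X$ along $\mathrm{id}_X\times\xi_m$. $\mathcal{P}$ is the covariant functor given on $f:X\to Y$ by $\mathcal{P}f=\xi_{m_f}$, where $m_f$ is the mono part of the (epi, mono)-factorisation of $(f\times\mathrm{id})\cdot\in_X:E_X\to Y\times\mathcal{P}X$, and $\eta_X=\xi_{\langle\mathrm{id},\mathrm{id}\rangle}:X\to\mathcal{P}X$ (the unit of the power-object monad). A relation from $X$ to $Y$ is a subobject of $X\times Y$ (an equivalence class of monos into $X\times Y$). An $F$-coalgebra is a morphism $\alpha:X\to FX$. Toposal AM-bisimulation: a relation from $X$ to $Y$ is a toposal AM-bisimulation from $\alpha$ to $\beta$ if for any mono $r:R\rightarrowtail X\times Y$ representing it there is a morphism $W:R\to\mathcal{P}FR$ such that $$(\eta_{FX}\times\eta_{FY})\cdot(\alpha\times\beta)\cdot r=\langle\mathcal{P}F\pi_1,\mathcal{P}F\pi_2\rangle\cdot\mathcal{P}Fr\cdot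 W:R\to\mathcal{P}FX\times\mathcal{P}FY .$$ Regular AM-bisimulation: a relation from $X$ to $Y$ is a regular AM-bisimulation from $\alpha$ to $\beta$ if for any mono $r:R\rightarrowtail X\times Y$ representing it there is a mono $w:W\rightarrowtail FR\times R$ such that $\pi_2\cdot w:W\to R$ is a regular epi and $$(\alpha\times\beta)\cdot r\cdot\pi_2\cdot w=\langle F\pi_1,F\pi_2\rangle\cdot Fr\cdot\pi_1\cdot w : W\to FX\times FY .$$ -}

module Defs where

open import Data.Product using (Σ-syntax; ∃-syntax; _,_; proj₁; proj₂)
  renaming (_×_ to _∧_)
open import Level using (Level; _⊔_) renaming (suc to lsuc)
open import Relation.Binary using (Setoid; IsEquivalence)
import Relation.Binary.Reasoning.Setoid as SetoidReasoning

private
  variable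
    o ℓ e : Level

-- Categories have hom-setoids; `≈` is equality of morphisms.
record Category (o ℓ e : Level) : Set (lsuc (o ⊔ ℓ ⊔ e)) where
  infix  4 _≈_ _⇒_
  infixr 9 _∘_
  field
    Obj : Set o
    _⇒_ : Obj → Obj → Set ℓ
    _≈_ : ∀ {A B} → A ⇒ B → A ⇒ B → Set e
    id  : ∀ {A} → A ⇒ A
    _∘_ : ∀ {A B C} → B ⇒ C → A ⇒ B → A ⇒ C

    ≈-equiv   : ∀ {A B} → IsEquivalence (_≈_ {A} {B})
    ∘-resp-≈  : ∀ {A B C} {f f′ : B ⇒ C} {g g′ : A ⇒ B} →
                f ≈ f′ → g ≈ g′ → f ∘ g ≈ f′ ∘ g′
    assoc     : ∀ {A B C D} {f : A ⇒ B} {g : B ⇒ C} {h : C ⇒ D} →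
                (h ∘ g) ∘ f ≈ h ∘ (g ∘ f)
    identityˡ : ∀ {A B} {f : A ⇒ B} → id ∘ f ≈ f
    identityʳ : ∀ {A B} {f : A ⇒ B} → f ∘ id ≈ f

  homSetoid : Obj → Obj → Setoid ℓ e
  homSetoid A B = record { Carrier = A ⇒ B ; _≈_ = _≈_ ; isEquivalence = ≈-equiv }

  module ≈-Equiv {A B : Obj} = IsEquivalence (≈-equiv {A} {B})
    using (refl; sym; trans)
  module HomReasoning {A B : Obj} = SetoidReasoning (homSetoid A B)

record Endofunctor (C : Category o ℓ e) : Set (o ⊔ ℓ ⊔ e) where
  open Category C
  field
    F₀ : Obj → Obj
    F₁ : ∀ {A B} → A ⇒ B → F₀ A ⇒ F₀ B

    F-resp-≈     : ∀ {A B} {f g : A ⇒ B} → f ≈ g → F₁ f ≈ F₁ g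
    identity     : ∀ {A} → F₁ (id {A}) ≈ id
    homomorphism : ∀ {A B C} {f : A ⇒ B} {g : B ⇒ C} → F₁ (g ∘ f) ≈ F₁ g ∘ F₁ f

Coalgebra : {C : Category o ℓ e} → Endofunctor C → Category.Obj C → Set ℓ
Coalgebra {C = C} F X = Category._⇒_ C X (Endofunctor.F₀ F X)

module Morphisms (C : Category o ℓ e) where
  open Category C
  open ≈-Equiv

  IsMono : ∀ {A B} → A ⇒ B → Set (o ⊔ ℓ ⊔ e)
  IsMono {A} f = ∀ {T} (g h : T ⇒ A) → f ∘ g ≈ f ∘ h → g ≈ h

  IsEpi : ∀ {A B} → A ⇒ B → Set (o ⊔ ℓ ⊔ e)
  IsEpi {B = B} f = ∀ {T} (g h : B ⇒ T) → g ∘ f ≈ h ∘ f → g ≈ h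

  record IsEqualizer {E A B} (i : E ⇒ A) (f g : A ⇒ B) : Set (o ⊔ ℓ ⊔ e) where
    field
      equality  : f ∘ i ≈ g ∘ i
      universal : ∀ {T} (h : T ⇒ A) → f ∘ h ≈ g ∘ h → T ⇒ E
      factors   : ∀ {T} {h : T ⇒ A} {eq : f ∘ h ≈ g ∘ h} → i ∘ universal h eq ≈ h
      unique    : ∀ {T} {h : T ⇒ A} {eq : f ∘ h ≈ g ∘ h} {u : T ⇒ E} →
                  i ∘ u ≈ h → u ≈ universal h eq

  record IsCoequalizer {A B Q} (f g : A ⇒ B) (q : B ⇒ Q) : Set (o ⊔ ℓ ⊔ e) where
    field
      equality  : q ∘ f ≈ q ∘ g
      universal : ∀ {T} (h : B ⇒ T) → h ∘ f ≈ h ∘ g → Q ⇒ T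
      factors   : ∀ {T} {h : B ⇒ T} {eq : h ∘ f ≈ h ∘ g} → universal h eq ∘ q ≈ h
      unique    : ∀ {T} {h : B ⇒ T} {eq : h ∘ f ≈ h ∘ g} {u : Q ⇒ T} →
                  u ∘ q ≈ h → u ≈ universal h eq

  IsRegularEpi : ∀ {B Q} → B ⇒ Q → Set (o ⊔ ℓ ⊔ e)
  IsRegularEpi {B} q = Σ[ A ∈ Obj ] Σ[ f ∈ (A ⇒ B) ] Σ[ g ∈ (A ⇒ B) ] IsCoequalizer f g q

  -- The square  f ∘ p ≈ g ∘ q  is a pullback; so p is a pullback of g along f.
  record IsPullback {P A B D} (p : P ⇒ A) (q : P ⇒ B) (f : A ⇒ D) (g : B ⇒ D)
         : Set (o ⊔ ℓ ⊔ e) where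
    field
      commute   : f ∘ p ≈ g ∘ q
      universal : ∀ {T} (h : T ⇒ A) (k : T ⇒ B) → f ∘ h ≈ g ∘ k → T ⇒ P
      factors₁  : ∀ {T} {h : T ⇒ A} {k : T ⇒ B} {eq : f ∘ h ≈ g ∘ k} →
                  p ∘ universal h k eq ≈ h
      factors₂  : ∀ {T} {h : T ⇒ A} {k : T ⇒ B} {eq : f ∘ h ≈ g ∘ k} →
                  q ∘ universal h k eq ≈ k
      unique    : ∀ {T} {h : T ⇒ A} {k : T ⇒ B} {eq : f ∘ h ≈ g ∘ k} {u : T ⇒ P} →
                  p ∘ u ≈ h → q ∘ u ≈ k → u ≈ universal h k eq

  record MonoInto (B : Obj) : Set (o ⊔ ℓ ⊔ e) where
    constructor mkMono
    field
      {dom} : Obj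
      arr   : dom ⇒ B
      mono  : IsMono arr

  infix 4 _∈_
  _∈_ : ∀ {T B} → T ⇒ B → MonoInto B → Set (ℓ ⊔ e)
  t ∈ m = ∃[ h ] MonoInto.arr m ∘ h ≈ t

  -- Subobjects are monos up to mutual factorisation, i.e. up to isomorphism over B.
  Subobjects : Obj → Setoid (o ⊔ ℓ ⊔ e) (ℓ ⊔ e)
  Subobjects B = record
    { Carrier = MonoInto B
    ; _≈_ = λ m n → (arr m ∈ n) ∧ (arr n ∈ m)
    ; isEquivalence = record
      { refl  = (id , identityʳ) , (id , identityʳ)
      ; sym   = λ (p , q) → q , p
      ; trans = λ {l} {m} {n} (p , q) (p′ , q′) →
          compose {l} {m} {n} p p′ , compose {n} {m} {l} q′ q
      }
    }
    where
    open MonoInto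
    compose : ∀ {l m n : MonoInto B} → arr l ∈ m → arr m ∈ n → arr l ∈ n
    compose (h , p) (k , q) =
      k ∘ h , trans (sym assoc) (trans (∘-resp-≈ q refl) p)

  record EpiMonoFactorisation {A B} (f : A ⇒ B) : Set (o ⊔ ℓ ⊔ e) where
    field
      image    : MonoInto B
    open MonoInto image public renaming (dom to Im; arr to m; mono to m-mono)
    field
      epi      : A ⇒ Im
      epi-epi  : IsEpi epi
      factors  : m ∘ epi ≈ f

-- Finite limits, presented by a terminal object, binary products and equalizers.
record FinitelyComplete (C : Category o ℓ e) : Set (o ⊔ ℓ ⊔ e) where
  open Category C
  open Morphisms C
  infixr 7 _×_
  field
    ⊤        : Obj
    !        : ∀ {A} → A ⇒ ⊤
    !-unique : ∀ {A} (f : A ⇒ ⊤) → f ≈ !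

    _×_      : Obj → Obj → Obj
    π₁       : ∀ {A B} → A × B ⇒ A
    π₂       : ∀ {A B} → A × B ⇒ B
    ⟨_,_⟩    : ∀ {T A B} → T ⇒ A → T ⇒ B → T ⇒ A × B
    project₁ : ∀ {T A B} {f : T ⇒ A} {g : T ⇒ B} → π₁ ∘ ⟨ f , g ⟩ ≈ f
    project₂ : ∀ {T A B} {f : T ⇒ A} {g : T ⇒ B} → π₂ ∘ ⟨ f , g ⟩ ≈ g
    ⟨⟩-unique : ∀ {T A B} {f : T ⇒ A} {g : T ⇒ B} {h : T ⇒ A × B} →
                π₁ ∘ h ≈ f → π₂ ∘ h ≈ g → h ≈ ⟨ f , g ⟩

    Eq       : ∀ {A B} → A ⇒ B → A ⇒ B → Obj
    eq       : ∀ {A B} (f g : A ⇒ B) → Eq f g ⇒ A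
    isEqualizer : ∀ {A B} (f g : A ⇒ B) → IsEqualizer (eq f g) f g

  infixr 8 _⁂_
  _⁂_ : ∀ {A B A′ B′} → A ⇒ A′ → B ⇒ B′ → A × B ⇒ A′ × B′
  f ⁂ g = ⟨ f ∘ π₁ , g ∘ π₂ ⟩

record Topos (o ℓ e : Level) : Set (lsuc (o ⊔ ℓ ⊔ e)) where
  field
    category         : Category o ℓ e
    finitelyComplete : FinitelyComplete category
  open Category category public
  open Morphisms category public
  open FinitelyComplete finitelyComplete public
  open MonoInto using (arr)
  field
    𝒫      : Obj → Obj
    -- arr (member X) is the mono  ∈_X : E_X ↣ X × 𝒫 X.
    member : (X : Obj) → MonoInto (X × 𝒫 X)
    ξ      : ∀ {X Y} → MonoInto (X × Y) → Y ⇒ 𝒫 X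

  -- "m is a pullback of ∈_X along id × g", for some top edge of the square.
  Classifies : ∀ {X Y} → Y ⇒ 𝒫 X → MonoInto (X × Y) → Set (o ⊔ ℓ ⊔ e)
  Classifies {X} g m =
    ∃[ p ] IsPullback (arr m) p (id ⁂ g) (arr (member X))

  field
    ξ-classifies : ∀ {X Y} (m : MonoInto (X × Y)) → Classifies (ξ m) m
    ξ-unique     : ∀ {X Y} (m : MonoInto (X × Y)) {g : Y ⇒ 𝒫 X} →
                   Classifies g m → g ≈ ξ m

-- (Epi, mono)-factorisations in a topos.  The image of f : A → B is
--   { b | ∀ S ∈ 𝒫 B. (∀ a. f a ∈ S) ⇒ b ∈ S },
-- where  { y | R y ⊆ S y }  is the equalizer of the names of R and R ∩ S.
-- Constructions are opaque so that only their specifications get unfolded.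
module Image (𝓒 : Topos o ℓ e) where
  open Topos 𝓒
  open ≈-Equiv
  open HomReasoning
  open MonoInto using (dom; arr; mono)

  private
    variable
      A B X Y T T′ : Obj

    infixr 9 _⟩∘⟨_
    _⟩∘⟨_ = ∘-resp-≈

    ⟨⟩-cong : {f f′ : T ⇒ A} {g g′ : T ⇒ B} → f ≈ f′ → g ≈ g′ → ⟨ f , g ⟩ ≈ ⟨ f′ , g′ ⟩
    ⟨⟩-cong p q = ⟨⟩-unique (trans project₁ p) (trans project₂ q)

    π-cong : {g h : T ⇒ A × B} → π₁ ∘ g ≈ π₁ ∘ h → π₂ ∘ g ≈ π₂ ∘ h → g ≈ h
    π-cong p q = trans (⟨⟩-unique p q) (sym (⟨⟩-unique refl refl))

    ⟨⟩∘ : {f : T ⇒ A} {g : T ⇒ B} {h : T′ ⇒ T} → ⟨ f , g ⟩ ∘ h ≈ ⟨ f ∘ h , g ∘ h ⟩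
    ⟨⟩∘ = ⟨⟩-unique (trans (sym assoc) (project₁ ⟩∘⟨ refl))
                    (trans (sym assoc) (project₂ ⟩∘⟨ refl))

    ⁂∘⟨⟩ : {A′ B′ : Obj} {f : A ⇒ A′} {g : B ⇒ B′} {h : T ⇒ A} {k : T ⇒ B} →
           (f ⁂ g) ∘ ⟨ h , k ⟩ ≈ ⟨ f ∘ h , g ∘ k ⟩
    ⁂∘⟨⟩ = trans ⟨⟩∘ (⟨⟩-cong (trans assoc (refl ⟩∘⟨ project₁))
                              (trans assoc (refl ⟩∘⟨ project₂)))

    ∈-resp : (m : MonoInto B) {s t : T ⇒ B} → s ≈ t → s ∈ m → t ∈ m
    ∈-resp m eq (h , p) = h , trans p eq

    ∈-∘ : (m : MonoInto B) {t : T ⇒ B} (s : T′ ⇒ T) → t ∈ m → t ∘ s ∈ m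
    ∈-∘ m s (h , p) = h ∘ s , trans (sym assoc) (p ⟩∘⟨ refl)

    equalizer : (f g : A ⇒ B) → MonoInto A
    equalizer f g = mkMono (eq f g) λ h k p →
      let h-eq = trans (sym assoc) (trans (equality ⟩∘⟨ refl) assoc)
      in trans (unique {eq = h-eq} refl) (sym (unique (sym p)))
      where open IsEqualizer (isEqualizer f g)

    ∈-equalizer : {f g : A ⇒ B} {t : T ⇒ A} → f ∘ t ≈ g ∘ t → t ∈ equalizer f g
    ∈-equalizer {f = f} {g} p = universal _ p , factors
      where open IsEqualizer (isEqualizer f g)

    equalizer-∈ : {f g : A ⇒ B} {t : T ⇒ A} → t ∈ equalizer f g → f ∘ t ≈ g ∘ t
    equalizer-∈ {f = f} {g} {t} (h , p) = begin
      f ∘ t           ≈⟨ refl ⟩∘⟨ sym p ⟩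
      f ∘ (eq f g ∘ h) ≈⟨ assoc ⟨
      (f ∘ eq f g) ∘ h ≈⟨ equality ⟩∘⟨ refl ⟩
      (g ∘ eq f g) ∘ h ≈⟨ assoc ⟩
      g ∘ (eq f g ∘ h) ≈⟨ refl ⟩∘⟨ p ⟩
      g ∘ t           ∎
      where open IsEqualizer (isEqualizer f g)

    record Preimage (f : A ⇒ B) (m : MonoInto B) : Set (o ⊔ ℓ ⊔ e) where
      field
        sub        : MonoInto A
        top        : dom sub ⇒ dom m
        isPullback : IsPullback (arr sub) top f (arr m)

    opaque
      preimage : (f : A ⇒ B) (m : MonoInto B) → Preimage f m
      preimage {A} {B} f m = record
        { sub = mkMono p p-mono
        ; top = q
        ; isPullback = record
          { commute   = commute
          ; universal = λ h k eq → universal ⟨ h , k ⟩ (lift-eq eq)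
          ; factors₁  = trans assoc (trans (refl ⟩∘⟨ factors) project₁)
          ; factors₂  = trans assoc (trans (refl ⟩∘⟨ factors) project₂)
          ; unique    = λ r s → unique (⟨⟩-unique (trans (sym assoc) r) (trans (sym assoc) s))
          }
        }
        where
        open IsEqualizer (isEqualizer (f ∘ π₁) (arr m ∘ π₂))
        i : Eq (f ∘ π₁) (arr m ∘ π₂) ⇒ A × dom m
        i = eq (f ∘ π₁) (arr m ∘ π₂)
        p : Eq (f ∘ π₁) (arr m ∘ π₂) ⇒ A
        p = π₁ ∘ i
        q : Eq (f ∘ π₁) (arr m ∘ π₂) ⇒ dom m
        q = π₂ ∘ i
        commute : f ∘ p ≈ arr m ∘ q
        commute = trans (sym assoc) (trans equality assoc)
        lift-eq : {h : T ⇒ A} {k : T ⇒ dom m} → f ∘ h ≈ arr m ∘ k →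
                  (f ∘ π₁) ∘ ⟨ h , k ⟩ ≈ (arr m ∘ π₂) ∘ ⟨ h , k ⟩
        lift-eq r = trans assoc (trans (refl ⟩∘⟨ project₁)
          (trans r (sym (trans assoc (refl ⟩∘⟨ project₂)))))
        p-mono : IsMono p
        p-mono g h r = mono (equalizer (f ∘ π₁) (arr m ∘ π₂)) g h (π-cong
          (trans (sym assoc) (trans r assoc))
          (trans (sym assoc) (trans (mono m (q ∘ g) (q ∘ h) q-eq) assoc)))
          where
          q-eq : arr m ∘ (q ∘ g) ≈ arr m ∘ (q ∘ h)
          q-eq = begin
            arr m ∘ (q ∘ g) ≈⟨ assoc ⟨
            (arr m ∘ q) ∘ g ≈⟨ commute ⟩∘⟨ refl ⟨
            (f ∘ p) ∘ g     ≈⟨ assoc ⟩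
            f ∘ (p ∘ g)     ≈⟨ refl ⟩∘⟨ r ⟩
            f ∘ (p ∘ h)     ≈⟨ assoc ⟨
            (f ∘ p) ∘ h     ≈⟨ commute ⟩∘⟨ refl ⟩
            (arr m ∘ q) ∘ h ≈⟨ assoc ⟩
            arr m ∘ (q ∘ h) ∎

    infix 10 _*_
    _*_ : (f : A ⇒ B) → MonoInto B → MonoInto A
    f * m = Preimage.sub (preimage f m)

    ∈-* : {f : A ⇒ B} {t : T ⇒ A} (m : MonoInto B) → f ∘ t ∈ m → t ∈ f * m
    ∈-* {f = f} m (h , p) = universal _ h (sym p) , factors₁
      where open IsPullback (Preimage.isPullback (preimage f m))

    *-∈ : {f : A ⇒ B} {t : T ⇒ A} (m : MonoInto B) → t ∈ f * m → f ∘ t ∈ m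
    *-∈ {f = f} m (h , p) = Preimage.top (preimage f m) ∘ h ,
      trans (sym assoc) (trans (sym commute ⟩∘⟨ refl) (trans assoc (refl ⟩∘⟨ p)))
      where open IsPullback (Preimage.isPullback (preimage f m))

    opaque
      _∩_ : MonoInto B → MonoInto B → MonoInto B
      R ∩ S = mkMono (arr R ∘ arr (arr R * S)) λ g h p →
        mono (arr R * S) g h (mono R _ _ (trans (sym assoc) (trans p assoc)))

      ∈-∩ : (R S : MonoInto B) {t : T ⇒ B} → t ∈ R → t ∈ S → t ∈ R ∩ S
      ∈-∩ R S (h , p) q with ∈-* {f = arr R} S (∈-resp S (sym p) q)
      ... | k , r = k , trans assoc (trans (refl ⟩∘⟨ r) p)

      ∩-∈₁ : (R S : MonoInto B) {t : T ⇒ B} → t ∈ R ∩ S → t ∈ R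
      ∩-∈₁ R S (h , p) = arr (arr R * S) ∘ h , trans (sym assoc) p

      ∩-∈₂ : (R S : MonoInto B) {t : T ⇒ B} → t ∈ R ∩ S → t ∈ S
      ∩-∈₂ R S (h , p) =
        ∈-resp S (trans (sym assoc) p) (*-∈ {f = arr R} S (h , refl))

    ∈-ξ : (m : MonoInto (X × Y)) {x : T ⇒ X} {y : T ⇒ Y} →
          ⟨ x , y ⟩ ∈ m → ⟨ x , ξ m ∘ y ⟩ ∈ member X
    ∈-ξ {X} m {x} {y} (h , p) = top ∘ h , (begin
      arr (member X) ∘ (top ∘ h) ≈⟨ assoc ⟨
      (arr (member X) ∘ top) ∘ h ≈⟨ commute ⟩∘⟨ refl ⟨
      ((id ⁂ ξ m) ∘ arr m) ∘ h   ≈⟨ assoc ⟩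
      (id ⁂ ξ m) ∘ (arr m ∘ h)   ≈⟨ refl ⟩∘⟨ p ⟩
      (id ⁂ ξ m) ∘ ⟨ x , y ⟩     ≈⟨ ⁂∘⟨⟩ ⟩
      ⟨ id ∘ x , ξ m ∘ y ⟩       ≈⟨ ⟨⟩-cong identityˡ refl ⟩
      ⟨ x , ξ m ∘ y ⟩            ∎)
      where
      top = proj₁ (ξ-classifies m)
      open IsPullback (proj₂ (ξ-classifies m))

    ξ-∈ : (m : MonoInto (X × Y)) {x : T ⇒ X} {y : T ⇒ Y} →
          ⟨ x , ξ m ∘ y ⟩ ∈ member X → ⟨ x , y ⟩ ∈ m
    ξ-∈ m (h , p) =
      universal _ h (trans ⁂∘⟨⟩ (trans (⟨⟩-cong identityˡ refl) (sym p))) , factors₁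
      where open IsPullback (proj₂ (ξ-classifies m))

    ext : {g h : Y ⇒ 𝒫 X} →
          (∀ {T} (x : T ⇒ X) (y : T ⇒ Y) → ⟨ x , g ∘ y ⟩ ∈ member X → ⟨ x , h ∘ y ⟩ ∈ member X) →
          (∀ {T} (x : T ⇒ X) (y : T ⇒ Y) → ⟨ x , h ∘ y ⟩ ∈ member X → ⟨ x , g ∘ y ⟩ ∈ member X) →
          g ≈ h
    ext {Y} {X} {g} {h} to from =
      trans (ξ-unique m (top , isPullback)) (sym (ξ-unique m (proj₁ toₘ , record
        { commute   = sym (trans (proj₂ toₘ) (sym (split h)))
        ; universal = λ u v p → proj₁ (fill u v p)
        ; factors₁  = λ {_} {u} {v} {p} → proj₂ (fill u v p)
        ; factors₂  = λ {_} {u} {v} {p} → mono (member X) _ _ (begin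
            arr (member X) ∘ (proj₁ toₘ ∘ proj₁ (fill u v p)) ≈⟨ assoc ⟨
            (arr (member X) ∘ proj₁ toₘ) ∘ proj₁ (fill u v p) ≈⟨ trans (proj₂ toₘ) (sym (split h)) ⟩∘⟨ refl ⟩
            ((id ⁂ h) ∘ arr m) ∘ proj₁ (fill u v p)           ≈⟨ assoc ⟩
            (id ⁂ h) ∘ (arr m ∘ proj₁ (fill u v p))           ≈⟨ refl ⟩∘⟨ proj₂ (fill u v p) ⟩
            (id ⁂ h) ∘ u                                      ≈⟨ p ⟩
            arr (member X) ∘ v                                ∎)
        ; unique    = λ {_} {u} {v} {p} r _ →
            mono m _ _ (trans r (sym (proj₂ (fill u v p))))
        })))
      where
      open Preimage (preimage (id ⁂ g) (member X)) renaming (sub to m)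
      split : (k : Y ⇒ 𝒫 X) {u : T ⇒ X × Y} → (id ⁂ k) ∘ u ≈ ⟨ π₁ ∘ u , k ∘ (π₂ ∘ u) ⟩
      split k = trans ⟨⟩∘ (⟨⟩-cong (trans assoc identityˡ) assoc)
      toₘ : ⟨ π₁ ∘ arr m , h ∘ (π₂ ∘ arr m) ⟩ ∈ member X
      toₘ = to _ _ (∈-resp (member X) (split g) (*-∈ (member X) (id , identityʳ)))
      fill : (u : T ⇒ X × Y) (v : T ⇒ dom (member X)) →
             (id ⁂ h) ∘ u ≈ arr (member X) ∘ v → u ∈ m
      fill u v p = ∈-* (member X) (∈-resp (member X) (sym (split g))
        (from _ _ (v , trans (sym p) (split h))))

    opaque
      [_⊆_] : (R S : MonoInto (X × Y)) → MonoInto Y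
      [ R ⊆ S ] = equalizer (ξ R) (ξ (R ∩ S))

      ∈-⊆ : (R S : MonoInto (X × Y)) {t : T ⇒ Y} →
            (∀ {T′} (x : T′ ⇒ X) (s : T′ ⇒ T) → ⟨ x , t ∘ s ⟩ ∈ R → ⟨ x , t ∘ s ⟩ ∈ S) →
            t ∈ [ R ⊆ S ]
      ∈-⊆ {X} {Y} {T} R S {t} sub = ∈-equalizer {f = ξ R} {g = ξ (R ∩ S)} (ext to from)
        where
        to : ∀ {T′} (x : T′ ⇒ X) (s : T′ ⇒ T) →
             ⟨ x , (ξ R ∘ t) ∘ s ⟩ ∈ member X → ⟨ x , (ξ (R ∩ S) ∘ t) ∘ s ⟩ ∈ member X
        to x s p = ∈-resp (member X) (⟨⟩-cong refl (sym assoc))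
                     (∈-ξ (R ∩ S) (∈-∩ R S r (sub x s r)))
          where
          r : ⟨ x , t ∘ s ⟩ ∈ R
          r = ξ-∈ R (∈-resp (member X) (⟨⟩-cong refl assoc) p)
        from : ∀ {T′} (x : T′ ⇒ X) (s : T′ ⇒ T) →
               ⟨ x , (ξ (R ∩ S) ∘ t) ∘ s ⟩ ∈ member X → ⟨ x , (ξ R ∘ t) ∘ s ⟩ ∈ member X
        from x s p = ∈-resp (member X) (⟨⟩-cong refl (sym assoc))
                       (∈-ξ R (∩-∈₁ R S r))
          where
          r : ⟨ x , t ∘ s ⟩ ∈ R ∩ S
          r = ξ-∈ (R ∩ S) (∈-resp (member X) (⟨⟩-cong refl assoc) p)

      ⊆-∈ : (R S : MonoInto (X × Y)) {x : T ⇒ X} {t : T ⇒ Y} →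
            t ∈ [ R ⊆ S ] → ⟨ x , t ⟩ ∈ R → ⟨ x , t ⟩ ∈ S
      ⊆-∈ {X} R S t∈ x∈ = ∩-∈₂ R S (ξ-∈ (R ∩ S)
        (∈-resp (member X) (⟨⟩-cong refl (equalizer-∈ t∈)) (∈-ξ R x∈)))

    top-sub : MonoInto B
    top-sub = mkMono id λ g h p → trans (sym identityˡ) (trans p identityˡ)

    -- { S ∈ 𝒫 B | ∀ a. f a ∈ S }
    upper : (f : A ⇒ B) → MonoInto (𝒫 B)
    upper {B = B} f = [ top-sub ⊆ (f ⁂ id) * member B ]

    -- { (S , b) | S ∈ upper f }
    upper-rel : (f : A ⇒ B) → MonoInto (𝒫 B × B)
    upper-rel f = π₁ * upper f

    swapped-member : (B : Obj) → MonoInto (𝒫 B × B)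
    swapped-member B = ⟨ π₂ , π₁ ⟩ * member B

    swap∘⟨⟩ : {f : T ⇒ A} {g : T ⇒ B} → ⟨ π₂ , π₁ ⟩ ∘ ⟨ f , g ⟩ ≈ ⟨ g , f ⟩
    swap∘⟨⟩ = trans ⟨⟩∘ (⟨⟩-cong project₂ project₁)

    opaque
      image-of : (f : A ⇒ B) → MonoInto B
      image-of {B = B} f = [ upper-rel f ⊆ swapped-member B ]

      f∈image : (f : A ⇒ B) → f ∈ image-of f
      f∈image {B = B} f = ∈-⊆ (upper-rel f) (swapped-member B) λ s a sa∈ →
        ∈-* (member B) (∈-resp (member B)
          (trans ⁂∘⟨⟩ (trans (⟨⟩-cong refl identityˡ) (sym swap∘⟨⟩)))
          (*-∈ (member B) (⊆-∈ top-sub ((f ⁂ id) * member B)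
            (∈-resp (upper f) project₁ (*-∈ (upper f) sa∈))
            (_ , identityˡ))))

      -- Every subobject through which f factors contains the image.
      image-least : (f : A ⇒ B) (k : MonoInto B) → f ∈ k → arr (image-of f) ∈ k
      image-least {B = B} f k f∈k = ∈-resp k project₁ (*-∈ k (ξ-∈ k′
        (∈-resp (member B) swap∘⟨⟩ (*-∈ (member B)
          (⊆-∈ (upper-rel f) (swapped-member B) (id , identityʳ)
            (∈-* (upper f) (∈-resp (upper f) (sym project₁) (∈-∘ (upper f) ! c∈))))))))
        where
        k′ : MonoInto (B × ⊤)
        k′ = π₁ * k
        c∈ : ξ k′ ∈ upper f
        c∈ = ∈-⊆ top-sub ((f ⁂ id) * member B) λ a t _ → ∈-* (member B)
          (∈-resp (member B) (sym (trans ⁂∘⟨⟩ (⟨⟩-cong refl identityˡ)))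
            (∈-ξ k′ (∈-* k (∈-resp k (sym project₁) (∈-∘ k a f∈k)))))

  factorise : (f : A ⇒ B) → EpiMonoFactorisation f
  factorise {A} {B} f = record
    { image   = image-of f
    ; epi     = ε
    ; epi-epi = ε-epi
    ; factors = mε≈f
    }
    where
    m : dom (image-of f) ⇒ B
    m = arr (image-of f)
    ε : A ⇒ dom (image-of f)
    ε = proj₁ (f∈image f)
    mε≈f : m ∘ ε ≈ f
    mε≈f = proj₂ (f∈image f)
    ε-epi : IsEpi ε
    ε-epi g h p = trans (sym identityʳ) (trans (equalizer-∈ id∈) identityʳ)
      where
      i : MonoInto (dom (image-of f))
      i = equalizer g h
      mi : MonoInto B
      mi = mkMono (m ∘ arr i) λ u v q →
        mono i u v (mono (image-of f) _ _ (trans (sym assoc) (trans q assoc)))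
      ε∈i : ε ∈ i
      ε∈i = ∈-equalizer p
      f∈mi : f ∈ mi
      f∈mi = proj₁ ε∈i , trans assoc (trans (refl ⟩∘⟨ proj₂ ε∈i) mε≈f)
      m∈mi : m ∈ mi
      m∈mi = image-least f mi f∈mi
      id∈ : id ∈ i
      id∈ = proj₁ m∈mi , mono (image-of f) _ _
        (trans (sym assoc) (trans (proj₂ m∈mi) (sym identityʳ)))

module PowerObjectMonad (𝓒 : Topos o ℓ e) where
  open Topos 𝓒
  open ≈-Equiv
  open Image 𝓒 public using (factorise)

  -- The covariant action of 𝒫.  It does not depend on the factorisation used,
  -- since (epi, mono)-factorisations in a topos are unique up to isomorphism.
  𝒫₁ : ∀ {X Y} → X ⇒ Y → 𝒫 X ⇒ 𝒫 Y
  𝒫₁ {X} f = ξ (EpiMonoFactorisation.image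
    (factorise ((f ⁂ id) ∘ MonoInto.arr (member X))))

  diagonal : (X : Obj) → MonoInto (X × X)
  diagonal X = mkMono ⟨ id , id ⟩ λ g h p →
    trans (sym (π₁∘Δ g)) (trans (∘-resp-≈ refl p) (π₁∘Δ h))
    where
    π₁∘Δ : ∀ {T} (g : T ⇒ X) → π₁ ∘ (⟨ id , id ⟩ ∘ g) ≈ g
    π₁∘Δ g = trans (sym assoc) (trans (∘-resp-≈ project₁ refl) identityˡ)

  η : (X : Obj) → X ⇒ 𝒫 X
  η X = ξ (diagonal X)

module AczelMendler (𝓒 : Topos o ℓ e) (F : Endofunctor (Topos.category 𝓒)) where
  open Topos 𝓒
  open PowerObjectMonad 𝓒
  open Endofunctor F

  -- A relation is given by a representing mono; equality of relations is
  -- that of subobjects.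
  Relation : Obj → Obj → Set (o ⊔ ℓ ⊔ e)
  Relation X Y = MonoInto (X × Y)

  _Represents_ : ∀ {X Y} → MonoInto (X × Y) → Relation X Y → Set (ℓ ⊔ e)
  _Represents_ {X} {Y} r U = Setoid._≈_ (Subobjects (X × Y)) r U

  module _ {X Y : Obj} (U : Relation X Y) (α : Coalgebra F X) (β : Coalgebra F Y) where

    IsToposalAMBisimulation : Set (o ⊔ ℓ ⊔ e)
    IsToposalAMBisimulation =
      ∀ (rᴹ : MonoInto (X × Y)) → rᴹ Represents U →
      let open MonoInto rᴹ renaming (dom to R; arr to r) in
      Σ[ W ∈ (R ⇒ 𝒫 (F₀ R)) ]
        (η (F₀ X) ⁂ η (F₀ Y)) ∘ (α ⁂ β) ∘ r
          ≈ ⟨ 𝒫₁ (F₁ π₁) , 𝒫₁ (F₁ π₂) ⟩ ∘ 𝒫₁ (F₁ r) ∘ W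

    IsRegularAMBisimulation : Set (o ⊔ ℓ ⊔ e)
    IsRegularAMBisimulation =
      ∀ (rᴹ : MonoInto (X × Y)) → rᴹ Represents U →
      let open MonoInto rᴹ renaming (dom to R; arr to r) in
      Σ[ wᴹ ∈ MonoInto (F₀ R × R) ]
      let open MonoInto wᴹ renaming (arr to w) in
        IsRegularEpi (π₂ ∘ w) ∧
        ((α ⁂ β) ∘ r ∘ π₂ ∘ w ≈ ⟨ F₁ π₁ , F₁ π₂ ⟩ ∘ F₁ r ∘ π₁ ∘ w)

{-# OPTIONS --safe #-}
module Submission where

open import Level using (Level; _⊔_)
open import Function.Bundles using (_⇔_; mk⇔)
open import Data.Product using (∃-syntax; _,_; proj₁; proj₂)
  renaming (_×_ to _∧_)
open import Defs

-- A morphism W : R → 𝒫 (F R) is the same thing as a relation w ↣ F R × R, and we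
-- reason about it with generalised elements, epis playing the role of covers:
-- epis are stable under pullback and membership in a subobject is local for
-- them, so that  y ∊ 𝒫₁ f ∘ S  means that y is, on some cover, of the form f x
-- with x ∊ S.  Since  z ∊ η ∘ c  means  z ≈ c,  the toposal condition
-- η ∘ c ≈ 𝒫₁ f ∘ W  says that f x ≈ c t for all (x , t) ∈ w and that every t is
-- covered by some such pair, i.e. that the projection w → R is epi; in a topos
-- every epi is regular.

module PowerObjectLogic {o ℓ e : Level} (𝓒 : Topos o ℓ e) where
  open Topos 𝓒
  open PowerObjectMonad 𝓒
  open ≈-Equiv
  open HomReasoning
  open MonoInto using (dom; arr; mono)

  private
    variable
      A B D T T′ V X Y Z : Obj

  -- Calculations with composites, pairings and epis.

  infixr 9 _⟩∘⟨_
  _⟩∘⟨_ : {f f′ : B ⇒ D} {g g′ : A ⇒ B} → f ≈ f′ → g ≈ g′ → f ∘ g ≈ f′ ∘ g′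
  _⟩∘⟨_ = ∘-resp-≈

  pullˡ : {f : B ⇒ D} {g : A ⇒ B} {h : A ⇒ D} {k : T ⇒ A} →
          f ∘ g ≈ h → f ∘ (g ∘ k) ≈ h ∘ k
  pullˡ p = trans (sym assoc) (p ⟩∘⟨ refl)

  pullʳ : {f : B ⇒ D} {g : A ⇒ B} {k : T ⇒ A} {h : T ⇒ B} →
          g ∘ k ≈ h → (f ∘ g) ∘ k ≈ f ∘ h
  pullʳ p = trans assoc (refl ⟩∘⟨ p)

  extendʳ : {f : B ⇒ D} {g : A ⇒ B} {f′ : V ⇒ D} {g′ : A ⇒ V} {k : T ⇒ A} →
            f ∘ g ≈ f′ ∘ g′ → f ∘ (g ∘ k) ≈ f′ ∘ (g′ ∘ k)
  extendʳ p = trans (pullˡ p) assoc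

  ⟨⟩-cong : {f f′ : T ⇒ A} {g g′ : T ⇒ B} → f ≈ f′ → g ≈ g′ → ⟨ f , g ⟩ ≈ ⟨ f′ , g′ ⟩
  ⟨⟩-cong p q = ⟨⟩-unique (trans project₁ p) (trans project₂ q)

  ⟨⟩-η : {h : T ⇒ A × B} → h ≈ ⟨ π₁ ∘ h , π₂ ∘ h ⟩
  ⟨⟩-η = ⟨⟩-unique refl refl

  ⟨⟩∘ : {f : T ⇒ A} {g : T ⇒ B} {h : T′ ⇒ T} → ⟨ f , g ⟩ ∘ h ≈ ⟨ f ∘ h , g ∘ h ⟩
  ⟨⟩∘ = ⟨⟩-unique (pullˡ project₁) (pullˡ project₂)

  ⁂∘ : {f : A ⇒ X} {g : B ⇒ Y} {h : T ⇒ A × B} →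
       (f ⁂ g) ∘ h ≈ ⟨ f ∘ (π₁ ∘ h) , g ∘ (π₂ ∘ h) ⟩
  ⁂∘ = trans ⟨⟩∘ (⟨⟩-cong assoc assoc)

  ⁂∘⟨⟩ : {f : A ⇒ X} {g : B ⇒ Y} {h : T ⇒ A} {k : T ⇒ B} →
         (f ⁂ g) ∘ ⟨ h , k ⟩ ≈ ⟨ f ∘ h , g ∘ k ⟩
  ⁂∘⟨⟩ = trans ⁂∘ (⟨⟩-cong (refl ⟩∘⟨ project₁) (refl ⟩∘⟨ project₂))

  ⟨⟩-injective : {f f′ : T ⇒ A} {g g′ : T ⇒ B} → ⟨ f , g ⟩ ≈ ⟨ f′ , g′ ⟩ → (f ≈ f′) ∧ (g ≈ g′)
  ⟨⟩-injective p =
    trans (sym project₁) (trans (refl ⟩∘⟨ p) project₁) ,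
    trans (sym project₂) (trans (refl ⟩∘⟨ p) project₂)

  ∘-epi : {f : B ⇒ D} {g : A ⇒ B} → IsEpi f → IsEpi g → IsEpi (f ∘ g)
  ∘-epi f-epi g-epi h k p = f-epi h k (g-epi _ _ (trans assoc (trans p (sym assoc))))

  epi-cancelʳ : {f : B ⇒ D} {g : A ⇒ B} {h : A ⇒ D} → f ∘ g ≈ h → IsEpi h → IsEpi f
  epi-cancelʳ p h-epi k l q = h-epi k l (begin
    k ∘ _       ≈⟨ refl ⟩∘⟨ p ⟨
    k ∘ (_ ∘ _) ≈⟨ extendʳ q ⟩
    l ∘ (_ ∘ _) ≈⟨ refl ⟩∘⟨ p ⟩
    l ∘ _       ∎)

  regular⇒epi : {f : A ⇒ B} → IsRegularEpi f → IsEpi f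
  regular⇒epi (_ , s , t , coeq) g h p = trans (unique {eq = h-eq} p) (sym (unique refl))
    where
    open IsCoequalizer coeq
    h-eq : (h ∘ _) ∘ s ≈ (h ∘ _) ∘ t
    h-eq = trans (pullʳ equality) (sym assoc)

  -- Subobjects and their generalised elements.

  ∈-resp : (m : MonoInto B) {s t : T ⇒ B} → s ≈ t → s ∈ m → t ∈ m
  ∈-resp m eq (h , p) = h , trans p eq

  ∈-∘ : (m : MonoInto B) {t : T ⇒ B} (s : T′ ⇒ T) → t ∈ m → t ∘ s ∈ m
  ∈-∘ m s (h , p) = h ∘ s , pullˡ p

  whole : (B : Obj) → MonoInto B
  whole B = mkMono id λ g h p → trans (sym identityˡ) (trans p identityˡ)

  _∘ᵐ_ : (m : MonoInto B) → MonoInto (dom m) → MonoInto B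
  m ∘ᵐ n = mkMono (arr m ∘ arr n) λ g h p →
    mono n g h (mono m _ _ (trans (sym assoc) (trans p assoc)))

  equalizer : (f g : A ⇒ B) → MonoInto A
  equalizer f g = mkMono (eq f g) λ h k p →
    trans (unique {eq = extendʳ equality} refl) (sym (unique (sym p)))
    where open IsEqualizer (isEqualizer f g)

  ∈-equalizer : {f g : A ⇒ B} {t : T ⇒ A} → f ∘ t ≈ g ∘ t → t ∈ equalizer f g
  ∈-equalizer {f = f} {g} p = universal _ p , factors
    where open IsEqualizer (isEqualizer f g)

  equalizer-∈ : {f g : A ⇒ B} {t : T ⇒ A} → t ∈ equalizer f g → f ∘ t ≈ g ∘ t
  equalizer-∈ {f = f} {g} (h , p) =
    trans (refl ⟩∘⟨ sym p) (trans (extendʳ equality) (refl ⟩∘⟨ p))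
    where open IsEqualizer (isEqualizer f g)

  record Pullback (f : A ⇒ D) (g : B ⇒ D) : Set (o ⊔ ℓ ⊔ e) where
    field
      {P}        : Obj
      p₁         : P ⇒ A
      p₂         : P ⇒ B
      isPullback : IsPullback p₁ p₂ f g
    open IsPullback isPullback public

  opaque
    pullback : (f : A ⇒ D) (g : B ⇒ D) → Pullback f g
    pullback {A = A} {B = B} f g = record
      { p₁ = π₁ ∘ arr i
      ; p₂ = π₂ ∘ arr i
      ; isPullback = record
        { commute   = trans (sym assoc) (trans equality assoc)
        ; universal = λ h k r → universal ⟨ h , k ⟩
            (trans (pullʳ project₁) (trans r (sym (pullʳ project₂))))
        ; factors₁  = trans (pullʳ factors) project₁
        ; factors₂  = trans (pullʳ factors) project₂
        ; unique    = λ r s → unique (⟨⟩-unique (trans (sym assoc) r) (trans (sym assoc) s))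
        }
      }
      where
      open IsEqualizer (isEqualizer (f ∘ π₁) (g ∘ π₂))
      i : MonoInto (A × B)
      i = equalizer (f ∘ π₁) (g ∘ π₂)

  infix 10 _*_
  _*_ : (A ⇒ B) → MonoInto B → MonoInto A
  f * m = mkMono p₁ λ g h r →
    trans (unique {eq = extendʳ commute} refl refl)
          (sym (unique (sym r) (mono m _ _ (begin
            arr m ∘ (p₂ ∘ h) ≈⟨ extendʳ commute ⟨
            f ∘ (p₁ ∘ h)     ≈⟨ refl ⟩∘⟨ r ⟨
            f ∘ (p₁ ∘ g)     ≈⟨ extendʳ commute ⟩
            arr m ∘ (p₂ ∘ g) ∎))))
    where open Pullback (pullback f (arr m))

  ∈-* : (f : A ⇒ B) (m : MonoInto B) {t : T ⇒ A} → f ∘ t ∈ m → t ∈ f * m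
  ∈-* f m (h , p) = universal _ h (sym p) , factors₁
    where open Pullback (pullback f (arr m))

  *-∈ : (f : A ⇒ B) (m : MonoInto B) {t : T ⇒ A} → t ∈ f * m → f ∘ t ∈ m
  *-∈ f m (h , p) = p₂ ∘ h , trans (sym (extendʳ commute)) (refl ⟩∘⟨ p)
    where open Pullback (pullback f (arr m))

  -- As `arr n` is mono, a square over it is a pullback once `m` has exactly the elements that `f`
  -- sends into `n`; the second leg and uniqueness then follow by cancelling monos.
  isPullback-∈ : (f : A ⇒ B) (m : MonoInto A) (n : MonoInto B) → f ∘ arr m ∈ n →
                 (∀ {T} (t : T ⇒ A) → f ∘ t ∈ n → t ∈ m) →
                 ∃[ p ] IsPullback (arr m) p f (arr n)
  isPullback-∈ f m n (p , np≈fm) from = p , record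
    { commute   = sym np≈fm
    ; universal = λ h k r → proj₁ (from h (k , sym r))
    ; factors₁  = λ {_} {h} {k} {r} → proj₂ (from h (k , sym r))
    ; factors₂  = λ {_} {h} {k} {r} → mono n _ _ (trans (extendʳ np≈fm)
                    (trans (refl ⟩∘⟨ proj₂ (from h (k , sym r))) r))
    ; unique    = λ {_} {h} {k} {r} s _ →
                    mono m _ _ (trans s (sym (proj₂ (from h (k , sym r)))))
    }

  -- Membership in power-objects and extensionality.

  infix 4 _∊_
  _∊_ : T ⇒ X → T ⇒ 𝒫 X → Set (ℓ ⊔ e)
  _∊_ {X = X} x S = ⟨ x , S ⟩ ∈ member X

  ∊-resp : {x x′ : T ⇒ X} {S S′ : T ⇒ 𝒫 X} → x ≈ x′ → S ≈ S′ → x ∊ S → x′ ∊ S′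
  ∊-resp p q = ∈-resp (member _) (⟨⟩-cong p q)

  ∊-∘ : {x : T ⇒ X} {S : T ⇒ 𝒫 X} (s : T′ ⇒ T) → x ∊ S → x ∘ s ∊ S ∘ s
  ∊-∘ s x∊S = ∈-resp (member _) ⟨⟩∘ (∈-∘ (member _) s x∊S)

  id⁂∘ : {g : Y ⇒ 𝒫 X} {t : T ⇒ X × Y} → (id ⁂ g) ∘ t ≈ ⟨ π₁ ∘ t , g ∘ (π₂ ∘ t) ⟩
  id⁂∘ = trans ⁂∘ (⟨⟩-cong identityˡ refl)

  id⁂∘⟨⟩ : {g : Y ⇒ 𝒫 X} {x : T ⇒ X} {y : T ⇒ Y} → (id ⁂ g) ∘ ⟨ x , y ⟩ ≈ ⟨ x , g ∘ y ⟩
  id⁂∘⟨⟩ = trans ⁂∘⟨⟩ (⟨⟩-cong identityˡ refl)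

  -- The relation named by `g`; the inverse of `ξ`, up to equality of subobjects.
  extent : (Y ⇒ 𝒫 X) → MonoInto (X × Y)
  extent {X = X} g = (id ⁂ g) * member X

  ∈-extent : (g : Y ⇒ 𝒫 X) {x : T ⇒ X} {y : T ⇒ Y} → x ∊ g ∘ y → ⟨ x , y ⟩ ∈ extent g
  ∈-extent g x∊ = ∈-* (id ⁂ g) (member _) (∈-resp (member _) (sym id⁂∘⟨⟩) x∊)

  extent-∈ : (g : Y ⇒ 𝒫 X) {t : T ⇒ X × Y} → t ∈ extent g → π₁ ∘ t ∊ g ∘ (π₂ ∘ t)
  extent-∈ g t∈ = ∈-resp (member _) id⁂∘ (*-∈ (id ⁂ g) (member _) t∈)

  ∈-ξ : (m : MonoInto (X × Y)) {x : T ⇒ X} {y : T ⇒ Y} → ⟨ x , y ⟩ ∈ m → x ∊ ξ m ∘ y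
  ∈-ξ m (h , p) = proj₁ (ξ-classifies m) ∘ h ,
    trans (sym (extendʳ commute)) (trans (refl ⟩∘⟨ p) id⁂∘⟨⟩)
    where open IsPullback (proj₂ (ξ-classifies m))

  ξ-∈ : (m : MonoInto (X × Y)) {x : T ⇒ X} {y : T ⇒ Y} → x ∊ ξ m ∘ y → ⟨ x , y ⟩ ∈ m
  ξ-∈ m (h , p) = universal _ h (trans id⁂∘⟨⟩ (sym p)) , factors₁
    where open IsPullback (proj₂ (ξ-classifies m))

  -- Under these hypotheses both `g` and `h` classify `extent g`, so both equal its `ξ`.
  ∊-ext : {g h : Y ⇒ 𝒫 X} →
          (∀ {T} (x : T ⇒ X) (y : T ⇒ Y) → x ∊ g ∘ y → x ∊ h ∘ y) →
          (∀ {T} (x : T ⇒ X) (y : T ⇒ Y) → x ∊ h ∘ y → x ∊ g ∘ y) →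
          g ≈ h
  ∊-ext {X = X} {g} {h} to from = trans
    (ξ-unique (extent g) (isPullback-∈ (id ⁂ g) (extent g) (member X)
      (*-∈ (id ⁂ g) (member X) (id , identityʳ)) (λ _ → ∈-* (id ⁂ g) (member X))))
    (sym (ξ-unique (extent g) (isPullback-∈ (id ⁂ h) (extent g) (member X)
      (∈-resp (member X) (sym id⁂∘) (to _ _ (extent-∈ g (id , identityʳ))))
      (λ t t∈ → ∈-resp (extent g) (sym ⟨⟩-η)
        (∈-extent g (from _ _ (∈-resp (member X) id⁂∘ t∈)))))))

  -- Epis as covers: locality, stability under pullback, regularity.

  -- An epi c identifies ξ K and ξ L as soon as K and L agree over its image.
  ⊆-along-epi : {c : A ⇒ Y} → IsEpi c → (K L : MonoInto (X × Y)) →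
                (∀ {T} (x : T ⇒ X) (a : T ⇒ A) → ⟨ x , c ∘ a ⟩ ∈ K → ⟨ x , c ∘ a ⟩ ∈ L) →
                (∀ {T} (x : T ⇒ X) (a : T ⇒ A) → ⟨ x , c ∘ a ⟩ ∈ L → ⟨ x , c ∘ a ⟩ ∈ K) →
                {x : T ⇒ X} {y : T ⇒ Y} → ⟨ x , y ⟩ ∈ K → ⟨ x , y ⟩ ∈ L
  ⊆-along-epi {c = c} c-epi K L to from xy∈K =
    ξ-∈ L (∊-resp refl (ξK≈ξL ⟩∘⟨ refl) (∈-ξ K xy∈K))
    where
    restrict : (K L : MonoInto (_ × _)) →
               (∀ {T} (x : T ⇒ _) (a : T ⇒ _) → ⟨ x , c ∘ a ⟩ ∈ K → ⟨ x , c ∘ a ⟩ ∈ L) →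
               ∀ {T} (x : T ⇒ _) (a : T ⇒ _) → x ∊ (ξ K ∘ c) ∘ a → x ∊ (ξ L ∘ c) ∘ a
    restrict K L sub x a x∊ =
      ∊-resp refl (sym assoc) (∈-ξ L (sub x a (ξ-∈ K (∊-resp refl assoc x∊))))
    -- Passing to names turns the inclusions over the image of `c` into an equation of morphisms,
    -- from which the epi `c` can be cancelled.
    ξK≈ξL : ξ K ≈ ξ L
    ξK≈ξL = c-epi _ _ (∊-ext (restrict K L to) (restrict L K from))

  -- Subobjects of `B` are viewed as relations between `⊤` and `B`, so that `⊆-along-epi` can
  -- compare `m` with the whole of `B`.
  ∈-local : {c : A ⇒ B} → IsEpi c → (m : MonoInto B) → c ∈ m → {t : T ⇒ B} → t ∈ m
  ∈-local {B = B} {c = c} c-epi m c∈m = ∈-resp m project₂ (*-∈ π₂ m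
    (⊆-along-epi c-epi (whole (⊤ × B)) (π₂ * m)
      (λ _ a _ → ∈-* π₂ m (∈-resp m (sym project₂) (∈-∘ m a c∈m)))
      (λ _ _ _ → _ , identityˡ)
      {x = !} (_ , identityˡ)))

  -- The locus in `T` where `x` belongs to `S` is a subobject through which the epi `c` factors,
  -- hence all of `T`.
  ∊-local : {c : T′ ⇒ T} → IsEpi c → {x : T ⇒ X} {S : T ⇒ 𝒫 X} → x ∘ c ∊ S ∘ c → x ∊ S
  ∊-local c-epi {x} {S} x∊ = ∈-resp (member _) identityʳ (*-∈ ⟨ x , S ⟩ (member _)
    (∈-local c-epi (⟨ x , S ⟩ * member _)
      (∈-* ⟨ x , S ⟩ (member _) (∈-resp (member _) (sym ⟨⟩∘) x∊))))

  -- Over the image of c, the graph of b agrees with its restriction to the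
  -- equalizer of two morphisms that are identified by the pullback of c.
  epi-stable : {c : A ⇒ B} → IsEpi c → (b : T ⇒ B) → IsEpi (Pullback.p₁ (pullback b c))
  epi-stable {B = B} {T = T} {c = c} c-epi b g h p =
    trans (sym identityʳ) (trans (equalizer-∈ id∈) identityʳ)
    where
    open Pullback (pullback b c)
    E : MonoInto T
    E = equalizer g h
    graph : MonoInto (T × B)
    graph = mkMono ⟨ id , b ⟩ λ u v q → begin
      u                     ≈⟨ trans (pullˡ project₁) identityˡ ⟨
      π₁ ∘ (⟨ id , b ⟩ ∘ u) ≈⟨ refl ⟩∘⟨ q ⟩
      π₁ ∘ (⟨ id , b ⟩ ∘ v) ≈⟨ trans (pullˡ project₁) identityˡ ⟩
      v                     ∎
    graph∘ : {s : T′ ⇒ T} → ⟨ id , b ⟩ ∘ s ≈ ⟨ s , b ∘ s ⟩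
    graph∘ = trans ⟨⟩∘ (⟨⟩-cong identityˡ refl)
    over : ∀ {T′} (t : T′ ⇒ T) (a : T′ ⇒ _) → ⟨ t , c ∘ a ⟩ ∈ graph → ⟨ t , c ∘ a ⟩ ∈ graph ∘ᵐ E
    over t a (s , q) = proj₁ s∈E , trans (pullʳ (proj₂ s∈E)) q
      where
      bs≈ca : b ∘ s ≈ c ∘ a
      bs≈ca = proj₂ (⟨⟩-injective (trans (sym graph∘) q))
      u : _ ⇒ P
      u = universal s a bs≈ca
      s∈E : s ∈ E
      s∈E = ∈-equalizer (begin
        g ∘ s        ≈⟨ refl ⟩∘⟨ factors₁ {eq = bs≈ca} ⟨
        g ∘ (p₁ ∘ u) ≈⟨ extendʳ p ⟩
        h ∘ (p₁ ∘ u) ≈⟨ refl ⟩∘⟨ factors₁ {eq = bs≈ca} ⟩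
        h ∘ s        ∎)
    -- The generic element of the graph need not lie over `c`; `⊆-along-epi` lifts that restriction,
    -- and the graph then factors through its part over `E`.
    graph∈ : ⟨ id , b ⟩ ∈ graph ∘ᵐ E
    graph∈ = ⊆-along-epi c-epi graph (graph ∘ᵐ E) over
               (λ _ _ (s , q) → arr E ∘ s , trans (sym assoc) q) (id , identityʳ)
    id∈ : id ∈ E
    id∈ = proj₁ graph∈ ,
      proj₁ (⟨⟩-injective (trans (sym graph∘) (trans (sym assoc) (proj₂ graph∈))))

  -- An epi c is the coequalizer of its kernel pair: for h compatible with c, the
  -- image of ⟨ h , c ⟩ is the graph of the induced morphism.
  epi⇒regular : {c : A ⇒ B} → IsEpi c → IsRegularEpi c
  epi⇒regular {A = A} {B = B} {c = c} c-epi = P , p₁ , p₂ , record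
    { equality  = commute
    ; universal = Descent.descend
    ; factors   = λ {_} {h} {r} → Descent.descend-∘ h r
    ; unique    = λ {_} {h} {r} s → c-epi _ _ (trans s (sym (Descent.descend-∘ h r)))
    }
    where
    open Pullback (pullback c c)
    module Descent {T : Obj} (h : A ⇒ T) (r : h ∘ p₁ ≈ h ∘ p₂) where
      open EpiMonoFactorisation (factorise ⟨ h , c ⟩)
      π₁m : π₁ ∘ (m ∘ epi) ≈ h
      π₁m = trans (refl ⟩∘⟨ factors) project₁
      π₂m : (π₂ ∘ m) ∘ epi ≈ c
      π₂m = trans (pullʳ factors) project₂
      h-compatible : {a a′ : V ⇒ A} → c ∘ a ≈ c ∘ a′ → h ∘ a ≈ h ∘ a′
      h-compatible q = trans (refl ⟩∘⟨ sym (factors₁ {eq = q}))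
        (trans (extendʳ r) (refl ⟩∘⟨ factors₂))
      epi-compatible : {a a′ : V ⇒ A} → (π₂ ∘ m) ∘ (epi ∘ a) ≈ (π₂ ∘ m) ∘ (epi ∘ a′) →
                       epi ∘ a ≈ epi ∘ a′
      epi-compatible {a = a} {a′} q = m-mono _ _ (begin
        m ∘ (epi ∘ a)          ≈⟨ pullˡ factors ⟩
        ⟨ h , c ⟩ ∘ a          ≈⟨ ⟨⟩∘ ⟩
        ⟨ h ∘ a , c ∘ a ⟩      ≈⟨ ⟨⟩-cong (h-compatible ca≈ca′) ca≈ca′ ⟩
        ⟨ h ∘ a′ , c ∘ a′ ⟩    ≈⟨ ⟨⟩∘ ⟨
        ⟨ h , c ⟩ ∘ a′         ≈⟨ pullˡ factors ⟨
        m ∘ (epi ∘ a′)         ∎)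
        where
        ca≈ca′ : c ∘ a ≈ c ∘ a′
        ca≈ca′ = trans (sym (pullˡ π₂m)) (trans q (pullˡ π₂m))
      -- Two elements of the image are lifted through `epi` one after the other, on the common cover
      -- `Q.p₁ ∘ Q′.p₁`. There `epi-compatible` applies, and the cover is cancelled.
      π₂m-mono : IsMono (π₂ ∘ m)
      π₂m-mono g g′ q = ∘-epi (epi-stable epi-epi g) (epi-stable epi-epi (g′ ∘ Q.p₁)) g g′ (begin
        g ∘ (Q.p₁ ∘ Q′.p₁)      ≈⟨ g-lift ⟩
        epi ∘ (Q.p₂ ∘ Q′.p₁)    ≈⟨ epi-compatible (begin
          (π₂ ∘ m) ∘ (epi ∘ (Q.p₂ ∘ Q′.p₁)) ≈⟨ refl ⟩∘⟨ g-lift ⟨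
          (π₂ ∘ m) ∘ (g ∘ (Q.p₁ ∘ Q′.p₁))   ≈⟨ extendʳ q ⟩
          (π₂ ∘ m) ∘ (g′ ∘ (Q.p₁ ∘ Q′.p₁))  ≈⟨ refl ⟩∘⟨ g′-lift ⟩
          (π₂ ∘ m) ∘ (epi ∘ Q′.p₂)          ∎) ⟩
        epi ∘ Q′.p₂             ≈⟨ g′-lift ⟨
        g′ ∘ (Q.p₁ ∘ Q′.p₁)     ∎)
        where
        module Q = Pullback (pullback g epi)
        module Q′ = Pullback (pullback (g′ ∘ Q.p₁) epi)
        g-lift : g ∘ (Q.p₁ ∘ Q′.p₁) ≈ epi ∘ (Q.p₂ ∘ Q′.p₁)
        g-lift = extendʳ Q.commute
        g′-lift : g′ ∘ (Q.p₁ ∘ Q′.p₁) ≈ epi ∘ Q′.p₂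
        g′-lift = trans (sym assoc) Q′.commute
      -- The epi `c` factors through the mono `π₂ ∘ m`, so by locality the identity does too.
      section : id ∈ mkMono (π₂ ∘ m) π₂m-mono
      section = ∈-local c-epi (mkMono (π₂ ∘ m) π₂m-mono) (epi , π₂m)
      s : B ⇒ Im
      s = proj₁ section
      s∘c : s ∘ c ≈ epi
      s∘c = π₂m-mono _ _ (trans (pullˡ (proj₂ section)) (trans identityˡ (sym π₂m)))
      descend : B ⇒ T
      descend = (π₁ ∘ m) ∘ s
      descend-∘ : descend ∘ c ≈ h
      descend-∘ = trans (pullʳ s∘c) (trans assoc π₁m)

  -- Elements of singletons and of direct images.

  ∊-η : {z c : T ⇒ X} → z ≈ c → z ∊ η X ∘ c
  ∊-η {X = X} {z} {c} p = ∈-ξ (diagonal X)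
    (c , trans ⟨⟩∘ (⟨⟩-cong (trans identityˡ (sym p)) identityˡ))

  η-∊ : {z c : T ⇒ X} → z ∊ η X ∘ c → z ≈ c
  η-∊ {X = X} z∊ =
    let (h , p) = ξ-∈ (diagonal X) z∊
        (q , r) = ⟨⟩-injective (trans (sym ⟨⟩∘) p)
    in trans (sym q) r

  ∊-𝒫₁ : (f : X ⇒ Y) {x : T ⇒ X} {S : T ⇒ 𝒫 X} → x ∊ S → f ∘ x ∊ 𝒫₁ f ∘ S
  ∊-𝒫₁ {X = X} f {x} {S} (u , p) = ∈-ξ image (epi ∘ u , (begin
    m ∘ (epi ∘ u)                  ≈⟨ extendʳ factors ⟩
    (f ⁂ id) ∘ (arr (member X) ∘ u) ≈⟨ refl ⟩∘⟨ p ⟩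
    (f ⁂ id) ∘ ⟨ x , S ⟩           ≈⟨ ⁂∘⟨⟩ ⟩
    ⟨ f ∘ x , id ∘ S ⟩             ≈⟨ ⟨⟩-cong refl identityˡ ⟩
    ⟨ f ∘ x , S ⟩                  ∎))
    where open EpiMonoFactorisation (factorise ((f ⁂ id) ∘ arr (member X)))

  -- The internal existential "`f x` equals `y` for some `x` in `S`". The witness lives on a cover
  -- because epis need not split.
  record CoveredBy (f : X ⇒ Y) (S : T ⇒ 𝒫 X) (y : T ⇒ Y) : Set (o ⊔ ℓ ⊔ e) where
    field
      {Cover}   : Obj
      cover     : Cover ⇒ T
      cover-epi : IsEpi cover
      point     : Cover ⇒ X
      point∊    : point ∊ S ∘ cover
      above     : f ∘ point ≈ y ∘ cover

  -- Membership gives a morphism `v` into the image; pulling the epi part of the factorisation back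
  -- along `v` yields the cover.
  𝒫₁-∊ : (f : X ⇒ Y) {y : T ⇒ Y} {S : T ⇒ 𝒫 X} → y ∊ 𝒫₁ f ∘ S → CoveredBy f S y
  𝒫₁-∊ {X = X} f {y} {S} y∊ = record
    { cover     = p₁
    ; cover-epi = epi-stable epi-epi v
    ; point     = π₁ ∘ (∈X ∘ p₂)
    ; point∊    = p₂ , trans ⟨⟩-η (⟨⟩-cong refl (trans (sym identityˡ) (proj₂ components)))
    ; above     = proj₁ components
    }
    where
    open EpiMonoFactorisation (factorise ((f ⁂ id) ∘ arr (member X)))
    ∈X = arr (member X)
    y∈image = ξ-∈ image y∊
    v = proj₁ y∈image
    open Pullback (pullback v epi)
    components = ⟨⟩-injective (begin
      ⟨ f ∘ (π₁ ∘ (∈X ∘ p₂)) , id ∘ (π₂ ∘ (∈X ∘ p₂)) ⟩ ≈⟨ ⁂∘ ⟨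
      (f ⁂ id) ∘ (∈X ∘ p₂)                           ≈⟨ extendʳ factors ⟨
      m ∘ (epi ∘ p₂)                                 ≈⟨ refl ⟩∘⟨ commute ⟨
      m ∘ (v ∘ p₁)                                   ≈⟨ pullˡ (proj₂ y∈image) ⟩
      ⟨ y , S ⟩ ∘ p₁                                 ≈⟨ ⟨⟩∘ ⟩
      ⟨ y ∘ p₁ , S ∘ p₁ ⟩                            ∎)

  -- A preimage under `g` and then one under `f` exist on successive covers, which compose;
  -- `∊-local` descends membership from them. This fuses the two direct images in the toposal
  -- condition into one.
  𝒫₁-∘ : (g : Y ⇒ Z) (f : X ⇒ Y) → 𝒫₁ g ∘ 𝒫₁ f ≈ 𝒫₁ (g ∘ f)
  𝒫₁-∘ g f = ∊-ext to from
    where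
    to : ∀ {T} (z : T ⇒ _) (S : T ⇒ _) → z ∊ (𝒫₁ g ∘ 𝒫₁ f) ∘ S → z ∊ 𝒫₁ (g ∘ f) ∘ S
    to z S z∊ = ∊-local (∘-epi G.cover-epi F.cover-epi) (∊-resp
      (begin
        (g ∘ f) ∘ F.point          ≈⟨ pullʳ F.above ⟩
        g ∘ (G.point ∘ F.cover)    ≈⟨ extendʳ G.above ⟩
        z ∘ (G.cover ∘ F.cover)    ∎)
      (trans (refl ⟩∘⟨ assoc) (sym assoc))
      (∊-𝒫₁ (g ∘ f) F.point∊))
      where
      module G = CoveredBy (𝒫₁-∊ g (∊-resp refl assoc z∊))
      module F = CoveredBy (𝒫₁-∊ f (∊-resp refl assoc G.point∊))
    from : ∀ {T} (z : T ⇒ _) (S : T ⇒ _) → z ∊ 𝒫₁ (g ∘ f) ∘ S → z ∊ (𝒫₁ g ∘ 𝒫₁ f) ∘ S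
    from z S z∊ = ∊-local cover-epi (∊-resp
      (trans (sym assoc) above)
      (trans (refl ⟩∘⟨ sym assoc) (trans (sym assoc) (sym assoc ⟩∘⟨ refl)))
      (∊-𝒫₁ g (∊-𝒫₁ f point∊)))
      where open CoveredBy (𝒫₁-∊ (g ∘ f) z∊)

  -- Direct images that are singletons.

  module _ {V Z R : Obj} {f : V ⇒ Z} {c : R ⇒ Z} where

    -- `c` lies in its own singleton, hence in the direct image of `W`. The cover this provides
    -- factors through the projection of `extent W`.
    singleton-image⇒epi : {W : R ⇒ 𝒫 V} → η Z ∘ c ≈ 𝒫₁ f ∘ W → IsEpi (π₂ ∘ arr (extent W))
    singleton-image⇒epi {W} p = epi-cancelʳ
      (trans (pullʳ (proj₂ point∈)) project₂) cover-epi
      where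
      open CoveredBy (𝒫₁-∊ f (∊-resp refl p (∊-η refl)))
      point∈ : ⟨ point , cover ⟩ ∈ extent W
      point∈ = ∈-extent W point∊

    -- The generic pair in `extent W` has its `f`-image in the direct image of `W`, which is the
    -- singleton of `c`.
    singleton-image⇒commutes : {W : R ⇒ 𝒫 V} → η Z ∘ c ≈ 𝒫₁ f ∘ W →
      c ∘ (π₂ ∘ arr (extent W)) ≈ f ∘ (π₁ ∘ arr (extent W))
    singleton-image⇒commutes {W} p = sym (η-∊ (∊-resp refl
      (sym (extendʳ p)) (∊-𝒫₁ f (extent-∈ W (id , identityʳ)))))

    commutes⇒singleton-image : (w : MonoInto (V × R)) → IsEpi (π₂ ∘ arr w) →
      c ∘ (π₂ ∘ arr w) ≈ f ∘ (π₁ ∘ arr w) → η Z ∘ c ≈ 𝒫₁ f ∘ ξ w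
    commutes⇒singleton-image w π₂w-epi p = ∊-ext to from
      where
      -- By locality this may be checked over the epi `π₂ ∘ arr w`, where `π₁ ∘ arr w` is a
      -- preimage.
      c∊ : c ∊ 𝒫₁ f ∘ ξ w
      c∊ = ∊-local π₂w-epi (∊-resp (sym p) (sym assoc)
        (∊-𝒫₁ f (∈-ξ w (id , trans identityʳ ⟨⟩-η))))
      to : ∀ {T} (z : T ⇒ Z) (t : T ⇒ R) → z ∊ (η Z ∘ c) ∘ t → z ∊ (𝒫₁ f ∘ ξ w) ∘ t
      to z t z∊ = ∊-resp (sym (η-∊ (∊-resp refl assoc z∊))) refl (∊-∘ t c∊)
      from : ∀ {T} (z : T ⇒ Z) (t : T ⇒ R) → z ∊ (𝒫₁ f ∘ ξ w) ∘ t → z ∊ (η Z ∘ c) ∘ t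
      -- On the cover, `z` is the `f`-image of a point paired with `t` in `w`, so it agrees there
      -- with `c ∘ t`; the cover is then cancelled.
      from z t z∊ = ∊-resp refl (sym assoc) (∊-η (cover-epi _ _ (begin
        z ∘ cover              ≈⟨ above ⟨
        f ∘ point              ≈⟨ refl ⟩∘⟨ trans (pullʳ (proj₂ point∈)) project₁ ⟨
        f ∘ ((π₁ ∘ arr w) ∘ k) ≈⟨ extendʳ p ⟨
        c ∘ ((π₂ ∘ arr w) ∘ k) ≈⟨ refl ⟩∘⟨ trans (pullʳ (proj₂ point∈)) project₂ ⟩
        c ∘ (t ∘ cover)        ≈⟨ assoc ⟨
        (c ∘ t) ∘ cover        ∎)))
        where
        open CoveredBy (𝒫₁-∊ f (∊-resp refl assoc z∊))
        point∈ : ⟨ point , t ∘ cover ⟩ ∈ w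
        point∈ = ξ-∈ w (∊-resp refl assoc point∊)
        k = proj₁ point∈

-- Comparison of the two notions of bisimulation.

module AMBisimulations {o ℓ e : Level} (𝓒 : Topos o ℓ e)
                       (F : Endofunctor (Topos.category 𝓒)) where
  open Topos 𝓒
  open PowerObjectMonad 𝓒
  open PowerObjectLogic 𝓒
  open Endofunctor F
  open AczelMendler 𝓒 F
  open ≈-Equiv
  open MonoInto using (arr)

  module _ {X Y : Obj} (α : Coalgebra F X) (β : Coalgebra F Y) (rᴹ : MonoInto (X × Y)) where
    open MonoInto rᴹ renaming (dom to R; arr to r)

    ToposalWitness : (R ⇒ 𝒫 (F₀ R)) → Set e
    ToposalWitness W =
      (η (F₀ X) ⁂ η (F₀ Y)) ∘ (α ⁂ β) ∘ r ≈ ⟨ 𝒫₁ (F₁ π₁) , 𝒫₁ (F₁ π₂) ⟩ ∘ 𝒫₁ (F₁ r) ∘ W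

    RegularWitness : MonoInto (F₀ R × R) → Set e
    RegularWitness w =
      (α ⁂ β) ∘ r ∘ π₂ ∘ arr w ≈ ⟨ F₁ π₁ , F₁ π₂ ⟩ ∘ F₁ r ∘ π₁ ∘ arr w

    private
      -- For each index i, the toposal condition becomes `η ∘ cᵢ ≈ 𝒫₁ fᵢ ∘ W` and the regular one
      -- `cᵢ ∘ (π₂ ∘ w) ≈ fᵢ ∘ (π₁ ∘ w)`.
      c₁ : R ⇒ F₀ X
      c₁ = α ∘ π₁ ∘ r
      c₂ : R ⇒ F₀ Y
      c₂ = β ∘ π₂ ∘ r
      f₁ : F₀ R ⇒ F₀ X
      f₁ = F₁ π₁ ∘ F₁ r
      f₂ : F₀ R ⇒ F₀ Y
      f₂ = F₁ π₂ ∘ F₁ r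

      toposalˡ : (η (F₀ X) ⁂ η (F₀ Y)) ∘ (α ⁂ β) ∘ r ≈ ⟨ η (F₀ X) ∘ c₁ , η (F₀ Y) ∘ c₂ ⟩
      toposalˡ = trans (refl ⟩∘⟨ ⁂∘) ⁂∘⟨⟩

      toposalʳ : {W : R ⇒ 𝒫 (F₀ R)} → ⟨ 𝒫₁ (F₁ π₁) , 𝒫₁ (F₁ π₂) ⟩ ∘ 𝒫₁ (F₁ r) ∘ W
                 ≈ ⟨ 𝒫₁ f₁ ∘ W , 𝒫₁ f₂ ∘ W ⟩
      toposalʳ = trans ⟨⟩∘ (⟨⟩-cong (pullˡ (𝒫₁-∘ _ _)) (pullˡ (𝒫₁-∘ _ _)))

      regularˡ : {T : Obj} {t : T ⇒ R} → (α ⁂ β) ∘ r ∘ t ≈ ⟨ c₁ ∘ t , c₂ ∘ t ⟩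
      regularˡ = trans (sym assoc) (trans (⁂∘ ⟩∘⟨ refl) ⟨⟩∘)

      regularʳ : {T : Obj} {x : T ⇒ F₀ R} → ⟨ F₁ π₁ , F₁ π₂ ⟩ ∘ F₁ r ∘ x ≈ ⟨ f₁ ∘ x , f₂ ∘ x ⟩
      regularʳ = trans ⟨⟩∘ (⟨⟩-cong (sym assoc) (sym assoc))

    -- Both components share `W`, so they give commutation statements about the single mono
    -- `extent W`.
    toposal⇒regular : (W : R ⇒ 𝒫 (F₀ R)) → ToposalWitness W →
                      IsRegularEpi (π₂ ∘ arr (extent W)) ∧ RegularWitness (extent W)
    toposal⇒regular W p =
      let (p₁ , p₂) = ⟨⟩-injective (trans (sym toposalˡ) (trans p toposalʳ))
      in epi⇒regular (singleton-image⇒epi p₁) ,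
         trans regularˡ (trans
           (⟨⟩-cong (singleton-image⇒commutes p₁) (singleton-image⇒commutes p₂))
           (sym regularʳ))

    regular⇒toposal : (w : MonoInto (F₀ R × R)) → IsRegularEpi (π₂ ∘ arr w) →
                      RegularWitness w → ToposalWitness (ξ w)
    regular⇒toposal w π₂w-regular p =
      let (p₁ , p₂) = ⟨⟩-injective (trans (sym regularˡ) (trans p regularʳ))
      in trans toposalˡ (trans
           (⟨⟩-cong (commutes⇒singleton-image w π₂w-epi p₁)
                    (commutes⇒singleton-image w π₂w-epi p₂))
           (sym toposalʳ))
      where
      π₂w-epi : IsEpi (π₂ ∘ arr w)
      π₂w-epi = regular⇒epi π₂w-regular

proposition4p2 :
    ∀ {o ℓ e : Level} (𝓒 : Topos o ℓ e) (F : Endofunctor (Topos.category 𝓒)) →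
    let open Topos 𝓒 using (Obj)
        open AczelMendler 𝓒 F
    in {X Y : Obj} (U : Relation X Y) (α : Coalgebra F X) (β : Coalgebra F Y) →
       IsToposalAMBisimulation U α β ⇔ IsRegularAMBisimulation U α β
proposition4p2 𝓒 F U α β = mk⇔ toposal⇒regularᵁ regular⇒toposalᵁ
  where
  open Topos 𝓒 using (ξ)
  open PowerObjectLogic 𝓒 using (extent)
  open AczelMendler 𝓒 F
  open AMBisimulations 𝓒 F
  toposal⇒regularᵁ : IsToposalAMBisimulation U α β → IsRegularAMBisimulation U α β
  toposal⇒regularᵁ toposal r r≈U =
    let (W , p) = toposal r r≈U
    in extent W , toposal⇒regular α β r W p
  regular⇒toposalᵁ : IsRegularAMBisimulation U α β → IsToposalAMBisimulation U α β
  regular⇒toposalᵁ regular r r≈U =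
    let (w , π₂w-regular , p) = regular r r≈U
    in ξ w , regular⇒toposal α β r w π₂w-regular p
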